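{- Let $\mathbf{F}$ be a Fraïssé structure in $L$ and let $\mathbf{F}^{*}$ be a Fraïssé precompact expansion of $\mathbf{F}$ in $L^{*}$ whose age consists of rigid structures. Assume that the pair $(\mathrm{Age}(\mathbf{F}),\mathrm{Age}(\mathbf{F}^{*}))$ has the relative Ramsey property for structures and that $\mathrm{Age}(\mathbf{F}^{*})$ has the expansion property relative to $\mathrm{Age}(\mathbf{F})$. Then $\mathrm{Age}(\mathbf{F}^{*})$ has the Ramsey property.
   Context: $\mathbb{N}=\{0,1,2,\ldots\}$ and $[k]=\{0,\ldots,k-1\}$. $L$ is a countable first-order signature and $L^{*}=L\cup\{R_i : i\in I^{*}\}$, where $I^{*}$ is countable and each $R_i$ is a relation symbol not in $L$. A Fraïssé structure is a countable (infinite), locally finite (finitely generated substructures are finite), ultrahomogeneous structure (every isomorphism between finite substructures extends to an automorphism). $\mathrm{Age}(\mathbf{F})$ is the class of finite structures that embed in $\mathbf{F}$. An expansion $\mathbf{F}^{*}$ of $\mathbf{F}$ in $L^{*}$ is an $L^{*}$-structure whose $L$-reduct is $\mathbf{F}$; "Fraïssé expansion" means $\mathbf{F}^{*}$ is itself a Fraïssé structure in $L^{*}$. It is precompact if every element of $\mathrm{Age}(\mathbf{F})$ has only finitely many expansions in $\mathrm{Age}(\mathbf{F}^{*})$. Both have universe $\mathbb{N}$. A structure is rigid if its only automorphism is the identity. A class $\mathcal{K}^{*}$ of $L^{*}$-structures is an expansion in $L^{*}$ of a class $\mathcal{K}$ of $L$-structures if every element of $\mathcal{K}^{*}$ is an expansion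 of an element of $\mathcal{K}$ and every element of $\mathcal{K}$ has an expansion in $\mathcal{K}^{*}$. For $\mathbf{B}^{*}\in\mathcal{K}^{*}$, $\mathbf{B}$ denotes its $L$-reduct. $\binom{\mathbf{B}}{\mathbf{A}}$ is the set of substructures of $\mathbf{B}$ isomorphic to $\mathbf{A}$ (copies of $\mathbf{A}$), and $\binom{\mathbf{B}}{\mathbf{A}}_{\mathrm{Emb}}$ is the set of embeddings of $\mathbf{A}$ into $\mathbf{B}$. For $\widetilde{\mathbf{A}}_0,\widetilde{\mathbf{A}}_1\in\binom{\mathbf{B}}{\mathbf{A}}$ with universes $\tilde A_0,\tilde A_1$, write $\widetilde{\mathbf{A}}_0\cong_{\mathbf{B}^{*}}\widetilde{\mathbf{A}}_1$ if the substructures $\mathbf{B}^{*}\upharpoonright\tilde A_0$ and $\mathbf{B}^{*}\upharpoonright\tilde A_1$ of $\mathbf{B}^{*}$ are isomorphic. For $\mathcal{K}$ a class of finite $L$-structures and $\mathcal{K}^{*}$ an expansion of $\mathcal{K}$ in $L^{*}$, the pair $(\mathcal{K},\mathcal{K}^{*})$ has the relative Ramsey property for structures if for every $k\in\mathbb{N}$, $\mathbf{A}\in\mathcal{K}$, $\mathbf{B}^{*}\in\mathcal{K}^{*}$, there exists $\mathbf{C}\in\mathcal{K}$ such that for every coloring $c:\binom{\mathbf{C}}{\mathbf{A}}\to[k]$ there exists $b\in\binom{\mathbf{C}}{\mathbf{B}}_{\mathrm{Emb}}$ such that for all $\widetilde{\mathbf{A}}_0,\widetilde{\mathbf{A}}_1\in\binom{\mathbf{B}}{\mathbf{A}}$,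 $\widetilde{\mathbf{A}}_0\cong_{\mathbf{B}^{*}}\widetilde{\mathbf{A}}_1$ implies $c(b(\widetilde{\mathbf{A}}_0))=c(b(\widetilde{\mathbf{A}}_1))$. An expansion $\mathcal{K}^{*}$ of $\mathcal{K}$ has the expansion property relative to $\mathcal{K}$ if for every $\mathbf{A}\in\mathcal{K}$ there exists $\mathbf{B}\in\mathcal{K}$ such that for all $\mathbf{A}^{*},\mathbf{B}^{*}\in\mathcal{K}^{*}$ with $L$-reducts $\mathbf{A}$ and $\mathbf{B}$ respectively, $\mathbf{A}^{*}$ embeds in $\mathbf{B}^{*}$. A class $\mathcal{C}$ of finite structures has the Ramsey property if for every $k\in\mathbb{N}$ and $\mathbf{A},\mathbf{B}\in\mathcal{C}$ there exists $\mathbf{C}\in\mathcal{C}$ such that for every $c:\binom{\mathbf{C}}{\mathbf{A}}\to[k]$ there is $\widetilde{\mathbf{B}}\in\binom{\mathbf{C}}{\mathbf{B}}$ such that $c$ takes at most one value on $\binom{\widetilde{\mathbf{B}}}{\mathbf{A}}$. -}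

module Defs where

open import Data.Bool.Base using (Bool; T)
open import Data.Fin.Base using (Fin)
open import Data.List.Base using (List)
open import Data.List.Membership.Propositional using (_∈_)
import Data.List.Relation.Unary.Any as List
open import Data.Nat.Base using (ℕ)
open import Data.Product.Base using (Σ; Σ-syntax; ∃; ∃-syntax; _×_; _,_; proj₁; proj₂)
open import Data.Sum.Base using (_⊎_; inj₁; inj₂; [_,_]′)
open import Data.Vec.Base using (Vec; map)
open import Data.Vec.Relation.Unary.All using (All; universal)
open import Data.Vec.Relation.Unary.All.Properties using (map⁺)
open import Function.Base using (_∘_)
open import Function.Bundles using (_↣_; _↔_; _⇔_)
open import Function.Definitions using (Injective; StrictlySurjective)
open import Relation.Binary.PropositionalEquality using (_≡_; _≗_)

Countable : Set → Set
Countable X = X ↣ ℕ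

Finite : Set → Set
Finite X = ∃[ n ] (X ↔ Fin n)

record Signature : Set₁ where
  field
    Fun   : Set
    Rel   : Set
    arFun : Fun → ℕ
    arRel : Rel → ℕ

open Signature public

CountableSignature : Signature → Set
CountableSignature L = Countable (Fun L) × Countable (Rel L)

-- The signature L ∪ {Rᵢ : i ∈ I}, where Rᵢ has arity ar i. The disjoint
-- union makes the new symbols distinct from those of L.
infixl 6 _⊕_
_⊕_ : (L : Signature) {I : Set} → (I → ℕ) → Signature
Fun   (L ⊕ ar)         = Fun L
Rel   (_⊕_ L {I} ar)   = Rel L ⊎ I
arFun (L ⊕ ar)         = arFun L
arRel (L ⊕ ar)         = [ arRel L , ar ]′

-- The universe is a parameter, so that a structure and its expansions
-- have the same one.
record Structure (L : Signature) (X : Set) : Set₁ where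
  field
    fun : (f : Fun L) → Vec X (arFun L f) → X
    rel : (R : Rel L) → Vec X (arRel L R) → Set

open Structure public

-- Equality of structures with the same universe.
infix 4 _≈_
record _≈_ {L X} (A B : Structure L X) : Set where
  field
    fun-≈ : ∀ f xs → fun A f xs ≡ fun B f xs
    rel-≈ : ∀ R xs → rel A R xs ⇔ rel B R xs

module _ {L : Signature} {I : Set} {ar : I → ℕ} where

  reduct : ∀ {X} → Structure (L ⊕ ar) X → Structure L X
  fun (reduct A*)   = fun A*
  rel (reduct A*) R = rel A* (inj₁ R)

  _IsExpansionOf_ : ∀ {X} → Structure (L ⊕ ar) X → Structure L X → Set
  A* IsExpansionOf A = reduct A* ≈ A

module _ {L : Signature} {X Y : Set} where

  record IsEmbedding (A : Structure L X) (B : Structure L Y) (h : X → Y) : Set where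
    field
      injective : Injective _≡_ _≡_ h
      fun-hom   : ∀ f xs → h (fun A f xs) ≡ fun B f (map h xs)
      rel-iff   : ∀ R xs → rel A R xs ⇔ rel B R (map h xs)

  IsIsomorphism : Structure L X → Structure L Y → (X → Y) → Set
  IsIsomorphism A B h = IsEmbedding A B h × StrictlySurjective _≡_ h

  Embedding : Structure L X → Structure L Y → Set
  Embedding A B = ∃[ h ] IsEmbedding A B h

  infix 4 _≅_
  _≅_ : Structure L X → Structure L Y → Set
  A ≅ B = ∃[ h ] IsIsomorphism A B h

Rigid : ∀ {L X} → Structure L X → Set
Rigid A = ∀ h → IsIsomorphism A A h → ∀ x → h x ≡ x

-- Subsets are Bool-valued so that membership is proof-irrelevant: elements
-- of ⟦ U ⟧ are equal as soon as their first components are. Classically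
-- every subset has this form.
Subset : Set → Set
Subset X = X → Bool

⟦_⟧ : ∀ {X} → Subset X → Set
⟦_⟧ {X} U = Σ[ x ∈ X ] T (U x)

infix 4 _⊆_
_⊆_ : ∀ {X} → Subset X → Subset X → Set
U ⊆ V = ∀ x → T (U x) → T (V x)

-- V is the direct image h(U). A relation, because h(U) as a Boolean
-- predicate would depend on a decision procedure for the existential.
IsImage : ∀ {X Y : Set} → (X → Y) → Subset X → Subset Y → Set
IsImage h U V = ∀ y → T (V y) ⇔ (∃[ x ] T (U x) × h x ≡ y)

record Substructure {L X} (A : Structure L X) : Set where
  field
    univ   : Subset X
    closed : ∀ f xs → All (T ∘ univ) xs → T (univ (fun A f xs))

open Substructure public

infixl 7 _↾_
_↾_ : ∀ {L X} (A : Structure L X) (S : Substructure A) → Structure L ⟦ univ S ⟧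
fun (A ↾ S) f xs = fun A f (map proj₁ xs) , closed S f (map proj₁ xs) (map⁺ (universal proj₂ xs))
rel (A ↾ S) R xs = rel A R (map proj₁ xs)

-- The expansion only adds relations, so a subset closed in the reduct is
-- closed in the expansion.
inExpansion : ∀ {L I} {ar : I → ℕ} {X} {A* : Structure (L ⊕ ar) X} →
       Substructure (reduct A*) → Substructure A*
univ   (inExpansion S) = univ S
closed (inExpansion S) = closed S

-- binom(B, A), the substructures of B isomorphic to A.
record Copy {L X Y} (B : Structure L Y) (A : Structure L X) : Set where
  field
    sub : Substructure B
    iso : A ≅ B ↾ sub

  universe : Subset Y
  universe = univ sub

open Copy public

-- A colouring of binom(C, A) by [k] depends only on the substructure, not
-- on the way it is presented: neither on the isomorphism with A nor on the
-- representation of its universe.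
record Colouring {L X Y} (C : Structure L Y) (A : Structure L X) (k : ℕ) : Set where
  field
    colour      : Copy C A → Fin k
    colour-cong : ∀ P Q → universe P ≗ universe Q → colour P ≡ colour Q

open Colouring public

-- P ≅ Q as substructures of the expansion B*.
SameType : ∀ {L I} {ar : I → ℕ} {X Y} {A : Structure L X} (B* : Structure (L ⊕ ar) Y) →
           Copy (reduct B*) A → Copy (reduct B*) A → Set
SameType B* P Q = B* ↾ inExpansion (sub P) ≅ B* ↾ inExpansion (sub Q)

Class : Signature → Set₁
Class L = (X : Set) → Structure L X → Set

Age : ∀ {L} {X : Set} → Structure L X → Class L
Age F Y A = Finite Y × Embedding A F

data Generated {L X} (A : Structure L X) (G : X → Set) : X → Set where
  base  : ∀ {x} → G x → Generated A G x
  apply : ∀ f xs → All (Generated A G) xs → Generated A G (fun A f xs)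

LocallyFinite : ∀ {L X} → Structure L X → Set
LocallyFinite {X = X} A =
  (gs : List X) → ∃[ ys ] (∀ x → Generated A (_∈ gs) x → x ∈ ys)

Ultrahomogeneous : ∀ {L X} → Structure L X → Set
Ultrahomogeneous A =
  (S S′ : Substructure A) → Finite ⟦ univ S ⟧ → Finite ⟦ univ S′ ⟧ →
  ((h , _) : A ↾ S ≅ A ↾ S′) →
  ∃[ g ] IsIsomorphism A A g × (∀ x → g (proj₁ x) ≡ proj₁ (h x))

record IsFraïssé {L} (F : Structure L ℕ) : Set where
  field
    locallyFinite    : LocallyFinite F
    ultrahomogeneous : Ultrahomogeneous F

module _ {L : Signature} {I : Set} {ar : I → ℕ} where

  Precompact : ∀ {X} → Structure L X → Structure (L ⊕ ar) X → Set₁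
  Precompact F F* =
    (Y : Set) (A : Structure L Y) → Age F Y A →
    Σ[ As ∈ List (Structure (L ⊕ ar) Y) ]
      (∀ A* → Age F* Y A* → A* IsExpansionOf A → List.Any (A* ≈_) As)

  RelativeRamsey : Class L → Class (L ⊕ ar) → Set₁
  RelativeRamsey K K* =
    (k : ℕ)
    (X : Set) (A : Structure L X) → K X A →
    (Y : Set) (B* : Structure (L ⊕ ar) Y) → K* Y B* →
    Σ[ Z ∈ Set ] Σ[ C ∈ Structure L Z ] K Z C ×
      ((c : Colouring C A k) →
       Σ[ (b , _) ∈ Embedding (reduct B*) C ]
         ((P Q : Copy (reduct B*) A) → SameType B* P Q →
          (bP bQ : Copy C A) →
          IsImage b (universe P) (universe bP) →
          IsImage b (universe Q) (universe bQ) →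
          colour c bP ≡ colour c bQ))

  ExpansionProperty : Class L → Class (L ⊕ ar) → Set₁
  ExpansionProperty K K* =
    (X : Set) (A : Structure L X) → K X A →
    Σ[ Y ∈ Set ] Σ[ B ∈ Structure L Y ] K Y B ×
      ((A* : Structure (L ⊕ ar) X) (B* : Structure (L ⊕ ar) Y) →
       K* X A* → K* Y B* → A* IsExpansionOf A → B* IsExpansionOf B →
       Embedding A* B*)

-- The copies of A in a copy P of B are the copies of A in C that are
-- contained in P.
RamseyProperty : ∀ {L} → Class L → Set₁
RamseyProperty {L} K =
  (k : ℕ)
  (X : Set) (A : Structure L X) → K X A →
  (Y : Set) (B : Structure L Y) → K Y B →
  Σ[ Z ∈ Set ] Σ[ C ∈ Structure L Z ] K Z C ×
    ((c : Colouring C A k) →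
     Σ[ P ∈ Copy C B ]
       ((Q Q′ : Copy C A) → universe Q ⊆ universe P → universe Q′ ⊆ universe P →
        colour c Q ≡ colour c Q′))

{-# OPTIONS --safe #-}
module Submission where

-- Write A and B for the L-reducts of A* and B*. Expansions of A induced by
-- embeddings e : A → F fall into finitely many isomorphism types, by
-- precompactness, so each e has a type in some Fin n (embeddingTypes). The
-- same holds for an embedding of A into any D once an embedding of D in F,
-- hence an expansion of D in Age(F*), is chosen.
--
-- By the expansion property and joint embedding there is D in Age(F) such
-- that every expansion of D in Age(F*) contains B* and contains every
-- expansion of A in Age(F*). Fix an expansion D* of D, let C be given by the
-- relative Ramsey property for A, D* and n (k + 1) colours, and fix an
-- expansion C* of C. A colouring c of the copies of A* in C* extends to
-- copies P of A in C: the colour of P consists of its type in C* together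
-- with its value under c, or a default value if P is not a copy of A* in C*.
--
-- The relative Ramsey property gives b : D → C such that the type in D* of
-- a copy of A in D determines the colour of its image, and in particular
-- its type in D′, the expansion of D induced from C* by b. All types realised
-- in D* are realised in D′, and there are finitely many types, so this map
-- of types is injective (factor-injective): the type in D′ determines the
-- type in D*, and therefore the colour. Since D′ contains a copy of B*, and
-- all copies of A* in D′ have the same type, the image of that copy of B*
-- is monochromatic for c.
--
-- The default value makes the argument uniform in k, including k = 0.

open import Defs
open import Axiom.ExcludedMiddle using (ExcludedMiddle)
open import Data.Fin.Base using (Fin; zero; suc; combine; toℕ)
open import Data.Fin.Properties
  using (combine-injective; toℕ-injective; injective⇒≤; suc-injective)
open import Data.List.Base using (List; []; _∷_; _++_; length; lookup; tabulate; filter; deduplicate)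
open import Data.List.Membership.Propositional using (_∈_)
open import Data.List.Membership.Propositional.Properties
  using (∈-++⁺ˡ; ∈-++⁺ʳ; ∈-tabulate⁺; ∈-filter⁺; ∈-filter⁻; ∈-deduplicate⁺; ∈-deduplicate⁻; ∈-lookup)
open import Data.List.Relation.Unary.AllPairs using (_∷_)
import Data.List.Relation.Unary.All as ListAll
import Data.List.Relation.Unary.Any as ListAny
open import Data.List.Relation.Unary.Any.Properties using (lookup-index)
open import Data.List.Relation.Unary.Unique.Propositional using (Unique)
open import Data.List.Relation.Unary.Unique.DecPropositional.Properties using (deduplicate-!)
open import Data.Bool.Base using (Bool; true; false; T)
open import Data.Bool.Properties using (T?; T-irrelevant)
open import Data.Nat.Base using (ℕ; suc; _*_; _≤_; z≤n; s≤s)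
open import Data.Nat.Properties using (≤-antisym; 1+n≰n)
open import Data.Product.Base using (Σ-syntax; ∃; ∃-syntax; _×_; _,_; proj₁; proj₂)
open import Data.Sum.Base using (inj₁; inj₂)
open import Data.Unit.Base using (tt)
open import Data.Vec.Base using (Vec; []; _∷_; map)
open import Data.Vec.Properties using (map-∘; map-cong; map-id)
open import Data.Vec.Relation.Unary.All using (All; []; _∷_)
open import Function.Base using (_∘_; id)
open import Function.Bundles using (_⇔_; mk⇔; mk↔ₛ′; Equivalence; Inverse)
open import Function.Definitions using (Injective; StrictlySurjective)
import Function.Properties.Equivalence as ⇔
open import Level using (0ℓ)
open import Relation.Binary.PropositionalEquality
open import Relation.Nullary using (Dec; yes; no; ¬_; contradiction)
open import Relation.Nullary.Decidable using (isYes; toWitness; fromWitness)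

open IsEmbedding
open _≈_
open Equivalence using (to; from)

-- Embeddings and isomorphisms

module _ {L : Signature} where

  ∘-isEmbedding : ∀ {X Y Z} {A : Structure L X} {B : Structure L Y} {C : Structure L Z} {g h} →
                  IsEmbedding B C g → IsEmbedding A B h → IsEmbedding A C (g ∘ h)
  injective (∘-isEmbedding G H) = injective H ∘ injective G
  fun-hom (∘-isEmbedding {C = C} {g} {h} G H) f xs =
    trans (cong g (fun-hom H f xs))
      (trans (fun-hom G f (map h xs)) (cong (fun C f) (sym (map-∘ g h xs))))
  rel-iff (∘-isEmbedding {A = A} {C = C} {g} {h} G H) R xs =
    subst (λ ys → rel A R xs ⇔ rel C R ys) (sym (map-∘ g h xs))
      (⇔.trans (rel-iff H R xs) (rel-iff G R (map h xs)))

  ≈⇒isEmbedding : ∀ {X} {A B : Structure L X} → A ≈ B → IsEmbedding A B id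
  injective (≈⇒isEmbedding A≈B) = id
  fun-hom (≈⇒isEmbedding {B = B} A≈B) f xs =
    trans (fun-≈ A≈B f xs) (cong (fun B f) (sym (map-id xs)))
  rel-iff (≈⇒isEmbedding {A = A} {B} A≈B) R xs =
    subst (λ ys → rel A R xs ⇔ rel B R ys) (sym (map-id xs)) (rel-≈ A≈B R xs)

  ≈-refl : ∀ {X} {A : Structure L X} → A ≈ A
  fun-≈ ≈-refl f xs = refl
  rel-≈ ≈-refl R xs = ⇔.refl

  id-isEmbedding : ∀ {X} {A : Structure L X} → IsEmbedding A A id
  id-isEmbedding = ≈⇒isEmbedding ≈-refl

  -- A map through which one embedding factors over another is an embedding.
  factor-isEmbedding : ∀ {X Y Z} {A : Structure L X} {B : Structure L Y} {C : Structure L Z} {e e′ φ} →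
                       IsEmbedding A C e → IsEmbedding B C e′ → (∀ x → e′ (φ x) ≡ e x) →
                       IsEmbedding A B φ
  injective (factor-isEmbedding {e′ = e′} E E′ eq) {x} {y} p =
    injective E (trans (sym (eq x)) (trans (cong e′ p) (eq y)))
  fun-hom (factor-isEmbedding {A = A} {C = C} {e} {e′} {φ} E E′ eq) f xs =
    injective E′
      (trans (eq (fun A f xs))
        (trans (fun-hom E f xs)
          (trans (cong (fun C f) (trans (sym (map-cong eq xs)) (map-∘ e′ φ xs)))
            (sym (fun-hom E′ f (map φ xs))))))
  rel-iff (factor-isEmbedding {A = A} {C = C} {e} {e′} {φ} E E′ eq) R xs =
    ⇔.trans
      (subst (λ ys → rel A R xs ⇔ rel C R ys)
        (trans (sym (map-cong eq xs)) (map-∘ e′ φ xs)) (rel-iff E R xs))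
      (⇔.sym (rel-iff E′ R (map φ xs)))

  sameImage⇒≅ : ∀ {X Y Z} {A : Structure L X} {B : Structure L Y} {C : Structure L Z} {e e′} →
                IsEmbedding A C e → IsEmbedding B C e′ →
                (∀ x → ∃[ y ] e′ y ≡ e x) → (∀ y → ∃[ x ] e x ≡ e′ y) → A ≅ B
  sameImage⇒≅ E E′ into onto =
    (proj₁ ∘ into) , factor-isEmbedding E E′ (proj₂ ∘ into) ,
    λ y → proj₁ (onto y) , injective E′ (trans (proj₂ (into _)) (proj₂ (onto y)))

  ≅-sym : ∀ {X Y} {A : Structure L X} {B : Structure L Y} → A ≅ B → B ≅ A
  ≅-sym (h , H , onto) = sameImage⇒≅ id-isEmbedding H onto (λ x → h x , refl)

  ≅-trans : ∀ {X Y Z} {A : Structure L X} {B : Structure L Y} {C : Structure L Z} →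
            A ≅ B → B ≅ C → A ≅ C
  ≅-trans {A = A} {B} {C} (h , H , h-onto) (g , G , g-onto) =
    sameImage⇒≅ (∘-isEmbedding {A = A} {B} {C} G H) id-isEmbedding
      (λ x → g (h x) , refl)
      (λ z → let (y , gy) = g-onto z ; (x , hx) = h-onto y in x , trans (cong g hx) gy)

  ≈⇒≅ : ∀ {X} {A B : Structure L X} → A ≈ B → A ≅ B
  ≈⇒≅ A≈B = id , ≈⇒isEmbedding A≈B , λ x → x , refl

  inclusion : ∀ {X} (A : Structure L X) (S : Substructure A) → IsEmbedding (A ↾ S) A proj₁
  injective (inclusion A S) {x , p} {.x , q} refl = cong (x ,_) (T-irrelevant p q)
  fun-hom (inclusion A S) f xs = refl
  rel-iff (inclusion A S) R xs = ⇔.refl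

-- Expansions

module _ {L : Signature} {I : Set} {ar : I → ℕ} where

  reduct-isEmbedding : ∀ {X Y} {A* : Structure (L ⊕ ar) X} {B* : Structure (L ⊕ ar) Y} {h} →
                       IsEmbedding A* B* h → IsEmbedding (reduct A*) (reduct B*) h
  injective (reduct-isEmbedding H) = injective H
  fun-hom (reduct-isEmbedding H)   = fun-hom H
  rel-iff (reduct-isEmbedding H) R = rel-iff H (inj₁ R)

  -- The expansion of A induced by a map e from A to B*: the new relations
  -- are pulled back along e. Taking the symbols of L from A itself makes A
  -- definitionally the reduct.
  expandAlong : ∀ {X Y} → Structure L X → (X → Y) → Structure (L ⊕ ar) Y → Structure (L ⊕ ar) X
  fun (expandAlong A e B*)             = fun A
  rel (expandAlong A e B*) (inj₁ R)    = rel A R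
  rel (expandAlong A e B*) (inj₂ i) xs = rel B* (inj₂ i) (map e xs)

  expandAlong-isEmbedding : ∀ {X Y} {A : Structure L X} {B : Structure L Y} {B* : Structure (L ⊕ ar) Y} {e} →
                            B* IsExpansionOf B → IsEmbedding A B e →
                            IsEmbedding (expandAlong A e B*) B* e
  injective (expandAlong-isEmbedding exp E) = injective E
  fun-hom (expandAlong-isEmbedding {e = e} exp E) f xs =
    trans (fun-hom E f xs) (sym (fun-≈ exp f (map e xs)))
  rel-iff (expandAlong-isEmbedding {e = e} exp E) (inj₁ R) xs =
    ⇔.trans (rel-iff E R xs) (⇔.sym (rel-≈ exp R (map e xs)))
  rel-iff (expandAlong-isEmbedding exp E) (inj₂ i) xs = ⇔.refl

-- Copies

T-injective : ∀ {a b : Bool} → (T a → T b) → (T b → T a) → a ≡ b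
T-injective {true}  {true}  f g = refl
T-injective {true}  {false} f g with () ← f tt
T-injective {false} {true}  f g with () ← g tt
T-injective {false} {false} f g = refl

-- The embedding of A that presents the copy P.
copyMap : ∀ {L X Y} {B : Structure L Y} {A : Structure L X} → Copy B A → X → Y
copyMap P = proj₁ ∘ proj₁ (iso P)

copyMap-isEmbedding : ∀ {L X Y} {B : Structure L Y} {A : Structure L X} (P : Copy B A) →
                      IsEmbedding A B (copyMap P)
copyMap-isEmbedding {B = B} P = ∘-isEmbedding (inclusion B (sub P)) (proj₁ (proj₂ (iso P)))

copyMap-∈ : ∀ {L X Y} {B : Structure L Y} {A : Structure L X} (P : Copy B A) x →
            T (universe P (copyMap P x))
copyMap-∈ P x = proj₂ (proj₁ (iso P) x)

copyMap-onto : ∀ {L X Y} {B : Structure L Y} {A : Structure L X} (P : Copy B A) y →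
               T (universe P y) → ∃[ x ] copyMap P x ≡ y
copyMap-onto P y p with proj₂ (proj₂ (iso P)) (y , p)
... | x , eq = x , cong proj₁ eq

-- Finite sets

lookup-injective : ∀ {X : Set} {xs : List X} → Unique xs → Injective _≡_ _≡_ (lookup xs)
lookup-injective (x∉ ∷ u) {zero}  {zero}  eq = refl
lookup-injective (x∉ ∷ u) {zero}  {suc j} eq = contradiction eq (ListAll.lookup x∉ (∈-lookup j))
lookup-injective (x∉ ∷ u) {suc i} {zero}  eq = contradiction (sym eq) (ListAll.lookup x∉ (∈-lookup i))
lookup-injective (x∉ ∷ u) {suc i} {suc j} eq = cong suc (lookup-injective u eq)

injective⇒strictlySurjective : ExcludedMiddle 0ℓ → ∀ {n} {g : Fin n → Fin n} →
                               Injective _≡_ _≡_ g → StrictlySurjective _≡_ g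
injective⇒strictlySurjective em {n} {g} inj i with em {∃[ j ] g j ≡ i}
... | yes hit = hit
... | no miss = contradiction (injective⇒≤ h-injective) 1+n≰n
  where
  -- If i is not a value of g, then g extends to an injection of Fin (suc n).
  h : Fin (suc n) → Fin n
  h zero    = i
  h (suc j) = g j

  h-injective : Injective _≡_ _≡_ h
  h-injective {zero}  {zero}  eq = refl
  h-injective {zero}  {suc j} eq = contradiction (j , sym eq) miss
  h-injective {suc j} {zero}  eq = contradiction (j , eq) miss
  h-injective {suc j} {suc l} eq = cong suc (inj eq)

-- If τ′ factors through τ, so that it has at most as many values, and every
-- value of τ is one of τ′, then the factor is injective on the values of τ.
factor-injective : ExcludedMiddle 0ℓ → ∀ {E : Set} {n} (τ τ′ : E → Fin n) →
                   (∀ x y → τ x ≡ τ y → τ′ x ≡ τ′ y) →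
                   (∀ x → ∃[ y ] τ′ y ≡ τ x) →
                   ∀ x y → τ′ x ≡ τ′ y → τ x ≡ τ y
factor-injective em {E} {n} τ τ′ factors realised x y eq =
  trans (τ≡g x) (trans (cong g eq) (sym (τ≡g y)))
  where
  Value′ : Fin n → Set
  Value′ i = ∃[ z ] τ′ z ≡ i

  -- On the values of τ′ a section of the factor, elsewhere the identity. Its
  -- values on values of τ′ are values of τ, hence of τ′, so it is injective.
  section : ∀ {i} → Dec (Value′ i) → Fin n
  section     (yes (z , _)) = τ z
  section {i} (no _)        = i

  g : Fin n → Fin n
  g i = section (em {Value′ i})

  section-injective : ∀ {i j} (i? : Dec (Value′ i)) (j? : Dec (Value′ j)) →
                      section i? ≡ section j? → i ≡ j
  section-injective (yes (z , p)) (yes (w , q)) e = trans (sym p) (trans (factors z w e) q)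
  section-injective (yes (z , p)) (no ¬j) e = contradiction (subst Value′ e (realised z)) ¬j
  section-injective (no ¬i) (yes (w , q)) e = contradiction (subst Value′ (sym e) (realised w)) ¬i
  section-injective (no _) (no _) e = e

  -- Since g is surjective, a value τ x of τ is g i for some i, which the
  -- factorisation identifies as τ′ x.
  preimage : ∀ x {i} (i? : Dec (Value′ i)) → section i? ≡ τ x → i ≡ τ′ x
  preimage x (yes (z , p)) e = trans (sym p) (factors z x e)
  preimage x (no ¬i) e = contradiction (subst Value′ (sym e) (realised x)) ¬i

  τ≡g : ∀ x → τ x ≡ g (τ′ x)
  τ≡g x with injective⇒strictlySurjective em
               (λ {i} {j} → section-injective (em {Value′ i}) (em {Value′ j})) (τ x)
  ... | i , gi≡τx = trans (sym gi≡τx) (cong g (preimage x em gi≡τx))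

-- The least index with the property P.
least : ExcludedMiddle 0ℓ → ∀ {n} (P : Fin n → Set) → ∃ P →
        ∃[ i ] P i × (∀ j → P j → toℕ i ≤ toℕ j)
least em {suc n} P w with em {P zero}
least em {suc n} P w           | yes p = zero , p , λ _ _ → z≤n
least em {suc n} P (zero  , p) | no ¬p = contradiction p ¬p
least em {suc n} P (suc i , p) | no ¬p with least em (P ∘ suc) (i , p)
... | j , q , minimal = suc j , q , λ where
      zero    r → contradiction r ¬p
      (suc l) r → s≤s (minimal l r)

least-cong : (em : ExcludedMiddle 0ℓ) → ∀ {n} {P Q : Fin n → Set} (p : ∃ P) (q : ∃ Q) →
             (∀ i → P i ⇔ Q i) → proj₁ (least em P p) ≡ proj₁ (least em Q q)
least-cong em {P = P} {Q} p q P⇔Q with least em P p | least em Q q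
... | i , pi , i-min | j , qj , j-min =
  toℕ-injective (≤-antisym (i-min j (from (P⇔Q j) qj)) (j-min i (to (P⇔Q i) pi)))

module _ (em : ExcludedMiddle 0ℓ) where

  listed⇒finite : ∀ {X : Set} (U : Subset X) (ys : List X) → (∀ x → T (U x) → x ∈ ys) → Finite ⟦ U ⟧
  listed⇒finite {X} U ys listed =
    length zs , mk↔ₛ′ position element
      (λ i → lookup-injective (deduplicate-! _≟_ us) (sym (lookup-index (∈zs (element i)))))
      (λ x → ⟦⟧-≡ (sym (lookup-index (∈zs x))))
    where
    _≟_ : (x y : X) → Dec (x ≡ y)
    x ≟ y = em

    us zs : List X
    us = filter (T? ∘ U) ys
    zs = deduplicate _≟_ us

    ⟦⟧-≡ : {x y : ⟦ U ⟧} → proj₁ x ≡ proj₁ y → x ≡ y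
    ⟦⟧-≡ {x , p} {.x , q} refl = cong (x ,_) (T-irrelevant p q)

    ∈zs : (x : ⟦ U ⟧) → proj₁ x ∈ zs
    ∈zs (x , p) = ∈-deduplicate⁺ _≟_ (∈-filter⁺ (T? ∘ U) (listed x p) p)

    position : ⟦ U ⟧ → Fin (length zs)
    position x = ListAny.index (∈zs x)

    element : Fin (length zs) → ⟦ U ⟧
    element i = lookup zs i ,
      proj₂ (∈-filter⁻ (T? ∘ U) {xs = ys} (∈-deduplicate⁻ _≟_ us (∈-lookup i)))

-- Joint embedding

  generatedSubstructure : ∀ {L X} (A : Structure L X) → LocallyFinite A → (gs : List X) →
                          Σ[ S ∈ Substructure A ] Finite ⟦ univ S ⟧ × (∀ {x} → x ∈ gs → T (univ S x))
  generatedSubstructure A locFin gs =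
    S , listed⇒finite (univ S) (proj₁ (locFin gs)) (λ x p → proj₂ (locFin gs) x (toWitness p)) ,
    fromWitness ∘ base
    where
    generated : ∀ {n} {xs : Vec _ n} → All (T ∘ (λ x → isYes (em {Generated A (_∈ gs) x}))) xs →
                All (Generated A (_∈ gs)) xs
    generated []       = []
    generated (p ∷ ps) = toWitness p ∷ generated ps

    S : Substructure A
    univ S x        = isYes (em {Generated A (_∈ gs) x})
    closed S f xs p = fromWitness (apply f xs (generated p))

  -- The range of a map on a finite set, as a list.
  image : ∀ {X Y : Set} → Finite X → (X → Y) → List Y
  image (n , X↔Fin) e = tabulate (e ∘ Inverse.from X↔Fin)

  ∈-image : ∀ {X Y : Set} (fin : Finite X) (e : X → Y) x → e x ∈ image fin e
  ∈-image (n , X↔Fin) e x =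
    subst (λ z → e z ∈ image (n , X↔Fin) e) (Inverse.strictlyInverseʳ X↔Fin x)
      (∈-tabulate⁺ (Inverse.to X↔Fin x))

  age-jointEmbedding : ∀ {L} {F : Structure L ℕ} → LocallyFinite F →
                       ∀ {X Y} {A : Structure L X} {B : Structure L Y} → Age F X A → Age F Y B →
                       Σ[ Z ∈ Set ] Σ[ C ∈ Structure L Z ] Age F Z C × Embedding A C × Embedding B C
  age-jointEmbedding {F = F} locFin (finX , e , E) (finY , e′ , E′)
    with generatedSubstructure F locFin (image finX e ++ image finY e′)
  ... | S , finS , contains =
    ⟦ univ S ⟧ , F ↾ S , (finS , proj₁ , inclusion F S) ,
    ((λ x → e x , contains (∈-++⁺ˡ (∈-image finX e x))) ,
      factor-isEmbedding E (inclusion F S) (λ _ → refl)) ,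
    ((λ y → e′ y , contains (∈-++⁺ʳ (image finX e) (∈-image finY e′ y))) ,
      factor-isEmbedding E′ (inclusion F S) (λ _ → refl))

-- Images of embeddings

  -- The range of e as a decided subset.
  range : ∀ {X Y : Set} → (X → Y) → Subset Y
  range e y = isYes (em {∃[ x ] e x ≡ y})

  ∈-range⁺ : ∀ {X Y : Set} (e : X → Y) {x y} → e x ≡ y → T (range e y)
  ∈-range⁺ e {x} eq = fromWitness (x , eq)

  ∈-range⁻ : ∀ {X Y : Set} (e : X → Y) {y} → T (range e y) → ∃[ x ] e x ≡ y
  ∈-range⁻ e = toWitness

  -- The copy of A that is the image of an embedding e. Its copyMap is
  -- definitionally e.
  imageCopy : ∀ {L X Y} {B : Structure L Y} {A : Structure L X} {e} → IsEmbedding A B e → Copy B A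
  imageCopy {X = X} {Y} {B} {A} {e} E = record
    { sub = S
    ; iso = (λ x → e x , ∈-range⁺ e refl) ,
            factor-isEmbedding E (inclusion B S) (λ _ → refl) ,
            λ (y , p) → let (x , eq) = ∈-range⁻ e p in x , injective (inclusion B S) eq
    }
    where
    preimages : ∀ {n} {ys : Vec Y n} → All (T ∘ range e) ys → ∃[ xs ] map e xs ≡ ys
    preimages []       = [] , refl
    preimages (p ∷ ps) =
      let (x , eq) = ∈-range⁻ e p ; (xs , eqs) = preimages ps in x ∷ xs , cong₂ _∷_ eq eqs

    S : Substructure B
    univ S = range e
    closed S f ys ps =
      let (xs , eq) = preimages ps in
      ∈-range⁺ e (trans (fun-hom E f xs) (cong (fun B f) eq))

  imageCopy-isImage : ∀ {L X Y Z} {B : Structure L Y} {C : Structure L Z} {A : Structure L X} {e b}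
                      (E : IsEmbedding A B e) (E′ : IsEmbedding A C (b ∘ e)) →
                      IsImage b (universe (imageCopy E)) (universe (imageCopy E′))
  imageCopy-isImage {e = e} {b} E E′ z = mk⇔
    (λ p → let (x , eq) = ∈-range⁻ (b ∘ e) p in e x , ∈-range⁺ e refl , eq)
    (λ (y , p , eq) → let (x , eq′) = ∈-range⁻ e p in ∈-range⁺ (b ∘ e) (trans (cong b eq′) eq))

  -- The signatures may differ: copies of A in B are compared with copies of
  -- expansions of A in expansions of B.
  imageCopy-universe : ∀ {L L′ X Y} {B : Structure L Y} {B′ : Structure L′ Y}
                       {A : Structure L X} {A′ : Structure L′ X} {e}
                       (E : IsEmbedding A B e) (P : Copy B′ A′) → (∀ x → copyMap P x ≡ e x) →
                       universe P ≗ universe (imageCopy E)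
  imageCopy-universe {e = e} E P eq y = T-injective
    (λ p → let (x , q) = copyMap-onto P y p in ∈-range⁺ e (trans (sym (eq x)) q))
    (λ p → let (x , q) = ∈-range⁻ e p in subst (T ∘ universe P) (trans (eq x) q) (copyMap-∈ P x))

-- Types of embeddings

  -- The isomorphism type of the expansion of A that an embedding of A in F
  -- induces, as an element of Fin n: a position in the list of expansions
  -- given by precompactness.
  embeddingTypes : ∀ {L I} {ar : I → ℕ} {F : Structure L ℕ} {F* : Structure (L ⊕ ar) ℕ} →
                   F* IsExpansionOf F → Precompact F F* →
                   ∀ {X} {A : Structure L X} → Finite X → Embedding A F →
                   ∃[ n ] Σ[ τ ∈ (Embedding A F → Fin n) ]
                     (∀ e e′ → τ e ≡ τ e′ ⇔ expandAlong A (proj₁ e) F* ≅ expandAlong A (proj₁ e′) F*)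
  embeddingTypes {F = F} {F*} exp precompact {X} {A} finX e₀ =
    length As , (λ e → proj₁ (label e)) , λ e e′ → mk⇔
      (λ eq → ≅-trans (label-≅ e) (≅-sym (subst (HasLabel e′) (sym eq) (label-≅ e′))))
      (λ ind≅ → least-cong em (listed e) (listed e′)
        (λ i → mk⇔ (≅-trans (≅-sym ind≅)) (≅-trans ind≅)))
    where
    induced : Embedding A F → Structure _ X
    induced (e , _) = expandAlong A e F*

    As : List (Structure _ X)
    As = proj₁ (precompact X A (finX , e₀))

    HasLabel : Embedding A F → Fin (length As) → Set
    HasLabel e i = induced e ≅ lookup As i

    listed : ∀ e → ∃ (HasLabel e)
    listed e with proj₂ (precompact X A (finX , e₀)) (induced e)
                    (finX , proj₁ e , expandAlong-isEmbedding exp (proj₂ e)) ≈-refl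
    ... | any = ListAny.index any , ≈⇒≅ (lookup-index any)

    -- The least index is taken because it depends only on the isomorphism
    -- type: the list may contain several isomorphic structures.
    label : ∀ e → ∃[ i ] HasLabel e i × (∀ j → HasLabel e j → toℕ i ≤ toℕ j)
    label e = least em (HasLabel e) (listed e)

    label-≅ : ∀ e → HasLabel e (proj₁ (label e))
    label-≅ e = proj₁ (proj₂ (label e))

-- Extending colourings

  -- The colouring c as a function of the universe: a copy of A* in C* keeps
  -- its colour, shifted by one, and a subset that is not the universe of
  -- such a copy has colour zero.
  module _ {L X Z} {A* : Structure L X} {C* : Structure L Z} {k} (c : Colouring C* A* k) where

    private
      HasCopy : Subset Z → Set
      HasCopy U = Σ[ Q ∈ Copy C* A* ] universe Q ≗ U

      value : ∀ {U} → Dec (HasCopy U) → Fin (suc k)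
      value (yes (Q , _)) = suc (colour c Q)
      value (no _)        = zero

    subsetColour : Subset Z → Fin (suc k)
    subsetColour U = value (em {HasCopy U})

    subsetColour-cong : ∀ {U V} → U ≗ V → subsetColour U ≡ subsetColour V
    subsetColour-cong {U} {V} U≗V with em {HasCopy U} | em {HasCopy V}
    ... | yes (P , p) | yes (Q , q) =
      cong suc (colour-cong c P Q (λ z → trans (p z) (trans (U≗V z) (sym (q z)))))
    ... | yes (P , p) | no ¬V = contradiction (P , λ z → trans (p z) (U≗V z)) ¬V
    ... | no ¬U | yes (Q , q) = contradiction (Q , λ z → trans (q z) (sym (U≗V z))) ¬U
    ... | no _ | no _ = refl

    subsetColour-copy : ∀ Q → subsetColour (universe Q) ≡ suc (colour c Q)
    subsetColour-copy Q with em {HasCopy (universe Q)}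
    ... | yes (P , p) = cong suc (colour-cong c P Q p)
    ... | no ¬Q = contradiction (Q , λ _ → refl) ¬Q

-- Transfer of the Ramsey property

module _ {L I} {ar : I → ℕ} {F : Structure L ℕ} {F* : Structure (L ⊕ ar) ℕ}
         (exp : F* IsExpansionOf F) where

  reduct-age : ∀ {X} {A* : Structure (L ⊕ ar) X} → Age F* X A* → Age F X (reduct A*)
  reduct-age (finX , e , E) = finX , e , ∘-isEmbedding (≈⇒isEmbedding exp) (reduct-isEmbedding E)

  expandAlong-age : ∀ {X} {A : Structure L X} → Age F X A → ((e , _) : Embedding A F) →
                    Age F* X (expandAlong A e F*)
  expandAlong-age (finX , _) (e , E) = finX , e , expandAlong-isEmbedding exp E

theorem3 : ExcludedMiddle 0ℓ →
    (L : Signature) → CountableSignature L →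
    (I* : Set) (ar : I* → ℕ) → Countable I* →
    (F : Structure L ℕ) → IsFraïssé F →
    (F* : Structure (L ⊕ ar) ℕ) → F* IsExpansionOf F →
    IsFraïssé F* → Precompact F F* →
    ((X : Set) (A* : Structure (L ⊕ ar) X) → Age F* X A* → Rigid A*) →
    RelativeRamsey (Age F) (Age F*) →
    ExpansionProperty (Age F) (Age F*) →
    RamseyProperty (Age F*)
theorem3 em L _ I* ar _ F fraïssé F* exp _ precompact _ ramsey expansion
         k X A* A*∈K* Y B* B*∈K*
  with embeddingTypes em exp precompact (proj₁ A*∈K*) (proj₂ (reduct-age exp A*∈K*))
     | expansion X (reduct A*) (reduct-age exp A*∈K*)
     | expansion Y (reduct B*) (reduct-age exp B*∈K*)
... | n , type , type⇔≅ | _ , Aᴱ , Aᴱ∈K , A-in-Aᴱ | _ , Bᴱ , Bᴱ∈K , B-in-Bᴱ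
  with age-jointEmbedding em (IsFraïssé.locallyFinite fraïssé) Aᴱ∈K Bᴱ∈K
... | W , D , D∈K@(_ , eD , ED) , (jA , JA) , (jB , JB)
  with ramsey (n * suc k) X (reduct A*) (reduct-age exp A*∈K*)
         W (expandAlong D eD F*) (expandAlong-age exp D∈K (eD , ED))
... | Z , C , C∈K@(_ , eC , EC) , homogeneous =
  Z , C* , expandAlong-age exp C∈K (eC , EC) , monochromatic
  where
  -- D contains Aᴱ and Bᴱ, so each of its expansions in Age(F*) contains all
  -- expansions of A in Age(F*), and B*.
  A  = reduct A*
  D* = expandAlong D eD F*
  C* = expandAlong C eC F*

  ED* : IsEmbedding D* F* eD
  ED* = expandAlong-isEmbedding exp ED

  EC* : IsEmbedding C* F* eC
  EC* = expandAlong-isEmbedding exp EC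

  -- The type depends only on the map, not on the proof that it embeds A.
  type-irrelevant : ∀ {f} (G H : IsEmbedding A F f) → type (f , G) ≡ type (f , H)
  type-irrelevant G H = from (type⇔≅ _ _) (≈⇒≅ ≈-refl)

  module _ (c : Colouring C* A* k) where

    -- The isomorphism type in C* of the image of f.
    typeInC : Embedding A C → Fin n
    typeInC (f , E) = type (eC ∘ f , ∘-isEmbedding EC E)

    -- The extension of c to all copies of A in C, recording also their types
    -- in C*.
    extended : Colouring C A (n * suc k)
    colour extended P =
      combine (typeInC (copyMap P , copyMap-isEmbedding P)) (subsetColour em c (universe P))
    colour-cong extended P Q P≗Q = cong₂ combine
      (from (type⇔≅ _ _)
        (sameImage⇒≅
          (expandAlong-isEmbedding exp (∘-isEmbedding EC (copyMap-isEmbedding P)))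
          (expandAlong-isEmbedding exp (∘-isEmbedding EC (copyMap-isEmbedding Q)))
          (λ x → let (y , eq) = copyMap-onto Q _ (subst T (P≗Q _) (copyMap-∈ P x))
                 in y , cong eC eq)
          (λ y → let (x , eq) = copyMap-onto P _ (subst T (sym (P≗Q _)) (copyMap-∈ Q y))
                 in x , cong eC eq)))
      (subsetColour-cong em c P≗Q)

    monochromatic : Σ[ P ∈ Copy C* B* ]
                      ((Q Q′ : Copy C* A*) → universe Q ⊆ universe P → universe Q′ ⊆ universe P →
                       colour c Q ≡ colour c Q′)
    monochromatic with homogeneous extended
    ... | (b , E) , same = P , colour-constant
      where
      -- The types of an embedding f in D* and in the expansion of D induced
      -- from C* by b, and the colour under c of the range of b ∘ f.
      τ τ′ : Embedding A D → Fin n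
      τ  (f , G) = type (eD ∘ f , ∘-isEmbedding ED G)
      τ′ (f , G) = typeInC (b ∘ f , ∘-isEmbedding E G)

      κ : Embedding A D → Fin (suc k)
      κ (f , _) = subsetColour em c (range em (b ∘ f))

      copy-≅ : ((f , G) : Embedding A D) →
               D* ↾ inExpansion (sub (imageCopy em G)) ≅ expandAlong A (eD ∘ f) F*
      copy-≅ (f , G) = sameImage⇒≅
        (∘-isEmbedding ED* (inclusion D* (inExpansion (sub (imageCopy em G)))))
        (expandAlong-isEmbedding exp (∘-isEmbedding ED G))
        (λ (_ , p) → let (x , eq) = ∈-range⁻ em f p in x , cong eD eq)
        (λ x → (f x , ∈-range⁺ em f refl) , refl)

      τ-determines : ∀ f g → τ f ≡ τ g → τ′ f ≡ τ′ g × κ f ≡ κ g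
      τ-determines f@(_ , G) g@(_ , H) eq
        with combine-injective _ _ _ _
               (same (imageCopy em G) (imageCopy em H)
                 (≅-trans (copy-≅ f) (≅-trans (to (type⇔≅ _ _) eq) (≅-sym (copy-≅ g))))
                 (imageCopy em (∘-isEmbedding E G)) (imageCopy em (∘-isEmbedding E H))
                 (imageCopy-isImage em G (∘-isEmbedding E G))
                 (imageCopy-isImage em H (∘-isEmbedding E H)))
      ... | types , colours =
        trans (type-irrelevant (proj₂ (inF f)) (proj₂ (viaCopy f)))
          (trans types (type-irrelevant (proj₂ (viaCopy g)) (proj₂ (inF g)))) , colours
        where
        -- The same maps into F, with two proofs that they are embeddings.
        inF viaCopy : Embedding A D → Embedding A F
        inF     (f , G) = eC ∘ b ∘ f , ∘-isEmbedding EC (∘-isEmbedding E G)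
        viaCopy (f , G) = eC ∘ b ∘ f ,
          ∘-isEmbedding EC (copyMap-isEmbedding (imageCopy em (∘-isEmbedding E G)))

      -- By the choice of Aᴱ, the expansion of A induced by f from D* embeds in
      -- the expansion of Aᴱ induced from C*.
      τ-realised : ∀ f → ∃[ g ] τ′ g ≡ τ f
      τ-realised (f , G)
        with EBA ← ∘-isEmbedding E JA
        with A-in-Aᴱ (expandAlong A (eD ∘ f) F*) (expandAlong Aᴱ (eC ∘ b ∘ jA) F*)
               (expandAlong-age exp (reduct-age exp A*∈K*) (eD ∘ f , ∘-isEmbedding ED G))
               (expandAlong-age exp Aᴱ∈K (eC ∘ b ∘ jA , ∘-isEmbedding EC EBA)) ≈-refl ≈-refl
      ... | g , H =
        (jA ∘ g , H′) ,
        from (type⇔≅ _ _)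
          (sameImage⇒≅
            (expandAlong-isEmbedding exp (∘-isEmbedding EC (∘-isEmbedding E H′)))
            (∘-isEmbedding (expandAlong-isEmbedding exp (∘-isEmbedding EC EBA)) H)
            (λ x → x , refl) (λ x → x , refl))
        where H′ = ∘-isEmbedding JA (reduct-isEmbedding H)

      B*-in-C* : Σ[ h ∈ (Y → W) ] IsEmbedding B* C* (b ∘ h)
      B*-in-C*
        with EBB ← ∘-isEmbedding EC (∘-isEmbedding E JB)
        with B-in-Bᴱ B* (expandAlong Bᴱ (eC ∘ b ∘ jB) F*)
               B*∈K* (expandAlong-age exp Bᴱ∈K (_ , EBB)) ≈-refl ≈-refl
      ... | h , H =
        jB ∘ h , factor-isEmbedding (∘-isEmbedding (expandAlong-isEmbedding exp EBB) H) EC* (λ _ → refl)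

      P : Copy C* B*
      P = imageCopy em (proj₂ B*-in-C*)

      -- An embedding of A in D whose image under b is the copy Q of A* in C*.
      Lift : Copy C* A* → Set
      Lift Q = Σ[ (f , _) ∈ Embedding A D ] (∀ x → copyMap Q x ≡ b (f x))

      lift : (Q : Copy C* A*) → universe Q ⊆ universe P → Lift Q
      lift Q Q⊆P =
        (f , factor-isEmbedding (reduct-isEmbedding (copyMap-isEmbedding Q)) E (sym ∘ bf≡Q)) ,
        bf≡Q
        where
        h = proj₁ B*-in-C*

        inP : ∀ x → ∃[ y ] b (h y) ≡ copyMap Q x
        inP x = ∈-range⁻ em (b ∘ h) (Q⊆P _ (copyMap-∈ Q x))

        f : X → W
        f x = h (proj₁ (inP x))

        bf≡Q : ∀ x → copyMap Q x ≡ b (f x)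
        bf≡Q x = sym (proj₂ (inP x))

      lift-≅ : (Q : Copy C* A*) (((f , _) , _) : Lift Q) → A* ≅ expandAlong A (eC ∘ b ∘ f) F*
      lift-≅ Q ((f , G) , eq) = sameImage⇒≅
        (∘-isEmbedding EC* (copyMap-isEmbedding Q))
        (expandAlong-isEmbedding exp (∘-isEmbedding EC (∘-isEmbedding E G)))
        (λ x → x , cong eC (sym (eq x))) (λ x → x , cong eC (eq x))

      lift-colour : (Q : Copy C* A*) ((f , _) : Lift Q) → κ f ≡ suc (colour c Q)
      lift-colour Q ((f , G) , eq) = trans
        (sym (subsetColour-cong em c (imageCopy-universe em (∘-isEmbedding E G) Q eq)))
        (subsetColour-copy em c Q)

      colour-constant : (Q Q′ : Copy C* A*) → universe Q ⊆ universe P → universe Q′ ⊆ universe P →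
                        colour c Q ≡ colour c Q′
      colour-constant Q Q′ Q⊆P Q′⊆P = suc-injective
        (trans (sym (lift-colour Q f))
          (trans (proj₂ (τ-determines (proj₁ f) (proj₁ f′) τ≡)) (lift-colour Q′ f′)))
        where
        f  = lift Q Q⊆P
        f′ = lift Q′ Q′⊆P

        τ≡ : τ (proj₁ f) ≡ τ (proj₁ f′)
        τ≡ = factor-injective em τ τ′ (λ g g′ eq → proj₁ (τ-determines g g′ eq)) τ-realised
          (proj₁ f) (proj₁ f′)
          (from (type⇔≅ _ _) (≅-trans (≅-sym (lift-≅ Q f)) (lift-≅ Q′ f′)))
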